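{- For every $n>0$ and every integer composition $\alpha$ of $n$, there is an isomorphism of partially ordered sets $\mathcal{T}_{\alpha}\cong(\mathcal{C}_{\alpha},\leq_{\mathsf{comp}})$ between the $\alpha$-Tamari lattice $\mathcal{T}_\alpha=(\mathfrak{S}_\alpha(231),\leq_L)$ and the set $\mathcal{C}_\alpha$ ordered componentwise.
   Context: Let $n>0$, $[n]=\{1,\dots,n\}$, and let $\alpha=(\alpha_1,\dots,\alpha_r)$ be a composition of $n$ (positive integers summing to $n$). Put $s_0=0$ and $s_a=\alpha_1+\cdots+\alpha_a$ for $a\in[r]$. The $a$-th $\alpha$-region is $\{s_{a-1}+1,\dots,s_a\}$, and $\varrho(i)$ denotes the index $a$ of the region containing $i$, i.e. $s_{a-1}<i\le s_a$. $\mathfrak{S}_n$ is the symmetric group and $\mathfrak{S}_\alpha=\{w\in\mathfrak{S}_n\mid w(i)<w(i+1)\text{ whenever }\varrho(i)=\varrho(i+1)\}$; write $w_i=w(i)$. An element $w\in\mathfrak{S}_\alpha$ has an $(\alpha,231)$-pattern if there are indices $i<j<k$, each in a different $\alpha$-region, with $w_i<w_j$ and $w_i=w_k+1$. $\mathfrak{S}_\alpha(231)$ is the set of $w\in\mathfrak{S}_\alpha$ having no $(\alpha,231)$-pattern. $\mathrm{Inv}(w)=\{(i,j)\mid i<j,\ w_i>w_j\}$, and the (left) weak order is $u\leq_L v\iff \mathrm{Inv}(u)\subseteq\mathrm{Inv}(v)$. $\mathcal{T}_\alpha=(\mathfrak{S}_\alpha(231),\leq_L)$ is the $\alpha$-Tamari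 lattice (known to be a lattice). $\mathcal{C}_\alpha$ is the set of integer tuples $(c_1,\dots,c_n)$ such that: (C1) $0\le c_i\le n-s_{\varrho(i)}$ for all $i\in[n]$; (C2) $c_i\le c_{i+1}$ for all $i\in[n-1]$ with $\varrho(i)=\varrho(i+1)$; (C3) $c_{s_a}\le c_i-s_a+s_{\varrho(i)}$ for all $i\in[s_{r-2}]$ and all $a\in\{\varrho(i)+1,\dots,r-1\}$ such that $c_i\ge s_a-s_{\varrho(i)}$ (this condition is vacuous if $r\le 2$). For integer tuples of length $n$, $\mathbf a\leq_{\mathsf{comp}}\mathbf b$ means $a_i\le b_i$ for all $i\in[n]$. -}

module Defs where

open import Level using (Level; 0ℓ; _⊔_)
open import Data.Nat.Base using (ℕ; zero; suc; _+_; _∸_; z≤n; s≤s)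
  renaming (_≤_ to _≤ₙ_; _<_ to _<ₙ_)
import Data.Nat.Properties as ℕ
open import Data.Integer.Base using (ℤ; +_; _-_; _≤_; 0ℤ) renaming (_+_ to _+ᶻ_)
import Data.Integer.Properties as ℤ
open import Data.Fin.Base using (Fin; zero; suc; toℕ; inject₁; _<_; _>_)
import Data.Fin.Properties as Fin
open import Data.Fin.Permutation using (Permutation′; _⟨$⟩ʳ_; _⟨$⟩ˡ_; inverseˡ; inverseʳ)
  renaming (_≈_ to _≈ₚ_)
open import Data.List.Base using (List; []; _∷_; length; sum; take)
open import Data.List.Relation.Unary.All using (All)
open import Data.Product.Base using (Σ; ∃; ∃-syntax; _×_; _,_; proj₁)
open import Data.Vec.Functional using (Vector)
open import Data.Vec.Functional.Relation.Binary.Pointwise using (Pointwise)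
open import Relation.Binary.Bundles using (Poset)
open import Relation.Binary.Definitions using (tri<; tri≈; tri>)
open import Relation.Binary.Morphism.Structures using (IsOrderIsomorphism)
import Relation.Binary.Construct.On as On
open import Relation.Binary.PropositionalEquality
  using (_≡_; _≢_; refl; sym; trans; cong; subst; subst₂)
open import Relation.Nullary using (¬_; yes; no; contradiction)
open import Relation.Unary using (Pred; _⊆′_)

private
  variable
    n : ℕ

record Composition (n : ℕ) : Set where
  field
    parts    : List ℕ
    positive : All (0 <ₙ_) parts
    total    : sum parts ≡ n

  r : ℕ
  r = length parts

  -- s a = α₁ + ⋯ + α_a; only 0 ≤ a ≤ r is meaningful (s a = n for a ≥ r).
  s : ℕ → ℕ
  s a = sum (take a parts)

-- The element i of Fin n stands for the element pos i of [n] = {1, …, n}.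
-- Values of permutations need no such shift: they are only ever compared
-- with each other.
pos : Fin n → ℕ
pos i = suc (toℕ i)

-- Regions are numbered from 1; the value on [] is never used for i ∈ [n].
region : List ℕ → ℕ → ℕ
region []       i = 0
region (p ∷ ps) i with i ℕ.≤? p
... | yes _ = 1
... | no  _ = suc (region ps (i ∸ p))

region-spec : ∀ ps i → 0 <ₙ i → i ≤ₙ sum ps →
              let a = region ps i in
              (1 ≤ₙ a × a ≤ₙ length ps) ×
              (sum (take (a ∸ 1) ps) <ₙ i × i ≤ₙ sum (take a ps))
region-spec []       i 0<i i≤0 = contradiction (ℕ.≤-trans 0<i i≤0) λ ()
region-spec (p ∷ ps) i 0<i i≤Σ with i ℕ.≤? p
... | yes i≤p = (s≤s z≤n , s≤s z≤n) , (0<i , ℕ.≤-trans i≤p (ℕ.m≤m+n p 0))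
... | no  i≰p with region ps (i ∸ p)
                 | region-spec ps (i ∸ p)
                     (ℕ.m<n⇒0<n∸m (ℕ.≰⇒> i≰p))
                     (ℕ.m≤n+o⇒m∸n≤o i p i≤Σ)
...   | suc a | (_ , a≤r) , (lo , hi) =
  (s≤s z≤n , s≤s a≤r) ,
  ( subst (p + sum (take a ps) <ₙ_) p+[i∸p]≡i (ℕ.+-monoʳ-< p lo)
  , subst (_≤ₙ p + sum (take (suc a) ps)) p+[i∸p]≡i (ℕ.+-monoʳ-≤ p hi) )
  where
  p+[i∸p]≡i : p + (i ∸ p) ≡ i
  p+[i∸p]≡i = ℕ.m+[n∸m]≡n (ℕ.<⇒≤ (ℕ.≰⇒> i≰p))

module _ (α : Composition n) where
  open Composition α

  ϱ : Fin n → ℕ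
  ϱ i = region parts (pos i)

  ϱ-spec : ∀ i → (1 ≤ₙ ϱ i × ϱ i ≤ₙ r) × (s (ϱ i ∸ 1) <ₙ pos i × pos i ≤ₙ s (ϱ i))
  ϱ-spec i = region-spec parts (pos i) (s≤s z≤n)
               (subst (pos i ≤ₙ_) (sym total) (Fin.toℕ<n i))

Inv : Permutation′ n → Pred (Fin n × Fin n) 0ℓ
Inv w (i , j) = i < j × (w ⟨$⟩ʳ i) > (w ⟨$⟩ʳ j)

infix 4 _≤L_
_≤L_ : Permutation′ n → Permutation′ n → Set
u ≤L v = Inv u ⊆′ Inv v

private
  mono⇒inflationary : (f : Fin n → Fin n) → (∀ {x y} → x < y → f x < f y) →
                      ∀ k x → toℕ x ≡ k → k ≤ₙ toℕ (f x)
  mono⇒inflationary f mono zero    x       eq = z≤n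
  mono⇒inflationary f mono (suc k) (suc x) eq = ℕ.≤-trans
    (s≤s (mono⇒inflationary f mono k (inject₁ x)
            (trans (Fin.toℕ-inject₁ x) (ℕ.suc-injective eq))))
    (mono (s≤s (ℕ.≤-reflexive (Fin.toℕ-inject₁ x))))

  ⟨$⟩ʳ-injective : (w : Permutation′ n) → ∀ {i j} → w ⟨$⟩ʳ i ≡ w ⟨$⟩ʳ j → i ≡ j
  ⟨$⟩ʳ-injective w eq = trans (sym (inverseˡ w)) (trans (cong (w ⟨$⟩ˡ_) eq) (inverseˡ w))

  transfer : (u v : Permutation′ n) → u ≤L v → v ≤L u →
             ∀ i j → (v ⟨$⟩ʳ i) < (v ⟨$⟩ʳ j) → (u ⟨$⟩ʳ i) < (u ⟨$⟩ʳ j)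
  transfer u v u≤v v≤u i j vi<vj with Fin.<-cmp i j
  ... | tri≈ _ refl _ = contradiction vi<vj (Fin.<-irrefl refl)
  ... | tri> _ _ j<i  with _ , uj>ui ← v≤u (j , i) (j<i , vi<vj) = uj>ui
  ... | tri< i<j _ _  with Fin.<-cmp (u ⟨$⟩ʳ i) (u ⟨$⟩ʳ j)
  ...   | tri< ui<uj _ _ = ui<uj
  ...   | tri≈ _ ui≡uj _ = contradiction (⟨$⟩ʳ-injective u ui≡uj) (Fin.<⇒≢ i<j)
  ...   | tri> _ _ ui>uj with _ , vi>vj ← u≤v (i , j) (i<j , ui>uj) =
    contradiction vi>vj (Fin.<-asym vi<vj)

  ≤L⇒≤ : (u v : Permutation′ n) → u ≤L v → v ≤L u →
         ∀ i → toℕ (v ⟨$⟩ʳ i) ≤ₙ toℕ (u ⟨$⟩ʳ i)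
  ≤L⇒≤ u v u≤v v≤u i =
    subst (λ k → toℕ (v ⟨$⟩ʳ i) ≤ₙ toℕ (u ⟨$⟩ʳ k)) (inverseˡ v)
      (mono⇒inflationary (λ x → u ⟨$⟩ʳ (v ⟨$⟩ˡ x))
        (λ {x} {y} x<y → transfer u v u≤v v≤u _ _
          (subst₂ _<_ (sym (inverseʳ v)) (sym (inverseʳ v)) x<y))
        _ (v ⟨$⟩ʳ i) refl)

≤L-antisym : (u v : Permutation′ n) → u ≤L v → v ≤L u → u ≈ₚ v
≤L-antisym u v u≤v v≤u i =
  Fin.toℕ-injective (ℕ.≤-antisym (≤L⇒≤ v u v≤u u≤v i) (≤L⇒≤ u v u≤v v≤u i))

≤L-reflexive : (u v : Permutation′ n) → u ≈ₚ v → u ≤L v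
≤L-reflexive u v u≈v (i , j) (i<j , ui>uj) = i<j , subst₂ _<_ (u≈v j) (u≈v i) ui>uj

weakOrder : ℕ → Poset 0ℓ 0ℓ 0ℓ
weakOrder n = record
  { Carrier = Permutation′ n
  ; _≈_     = _≈ₚ_
  ; _≤_     = _≤L_
  ; isPartialOrder = record
    { isPreorder = record
      { isEquivalence = record
        { refl  = λ i → refl
        ; sym   = λ u≈v i → sym (u≈v i)
        ; trans = λ u≈v v≈w i → trans (u≈v i) (v≈w i)
        }
      ; reflexive = λ {u} {v} → ≤L-reflexive u v
      ; trans     = λ u≤v v≤w p p∈u → v≤w p (u≤v p p∈u)
      }
    ; antisym = λ {u} {v} → ≤L-antisym u v
    }
  }

≤comp : ℕ → Poset 0ℓ 0ℓ 0ℓ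
≤comp n = record
  { Carrier = Vector ℤ n
  ; _≈_     = Pointwise _≡_
  ; _≤_     = Pointwise _≤_
  ; isPartialOrder = record
    { isPreorder = record
      { isEquivalence = record
        { refl  = λ i → refl
        ; sym   = λ a≈b i → sym (a≈b i)
        ; trans = λ a≈b b≈c i → trans (a≈b i) (b≈c i)
        }
      ; reflexive = λ a≈b i → ℤ.≤-reflexive (a≈b i)
      ; trans     = λ a≤b b≤c i → ℤ.≤-trans (a≤b i) (b≤c i)
      }
    ; antisym = λ a≤b b≤a i → ℤ.≤-antisym (a≤b i) (b≤a i)
    }
  }

module _ (α : Composition n) where
  open Composition α

  InSα : Permutation′ n → Set
  InSα w = ∀ i j → pos j ≡ suc (pos i) → ϱ α i ≡ ϱ α j → (w ⟨$⟩ʳ i) < (w ⟨$⟩ʳ j)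

  Has231 : Permutation′ n → Set
  Has231 w = ∃[ i ] ∃[ j ] ∃[ k ]
    (i < j × j < k) ×
    (ϱ α i ≢ ϱ α j × ϱ α j ≢ ϱ α k × ϱ α i ≢ ϱ α k) ×
    (w ⟨$⟩ʳ i) < (w ⟨$⟩ʳ j) ×
    toℕ (w ⟨$⟩ʳ i) ≡ suc (toℕ (w ⟨$⟩ʳ k))

  Sα231 : Set
  Sα231 = Σ (Permutation′ n) λ w → InSα w × ¬ Has231 w

  -- Elements are compared through the underlying permutation alone; the
  -- membership proofs play no role. Likewise for CPoset and tuples.
  Tamari : Poset 0ℓ 0ℓ 0ℓ
  Tamari = On.poset {B = Sα231} (weakOrder n) proj₁

  C1 : Vector ℤ n → Set
  C1 c = ∀ i → 0ℤ ≤ c i × c i ≤ + n - + s (ϱ α i)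

  C2 : Vector ℤ n → Set
  C2 c = ∀ i j → pos j ≡ suc (pos i) → ϱ α i ≡ ϱ α j → c i ≤ c j

  -- The entry c_{s_a} is c j for the unique j with pos j ≡ s a, which exists
  -- since 1 ≤ a ≤ r. For r < 2 truncated subtraction gives s (r ∸ 2) = 0, so
  -- the condition is vacuous, as intended for all r ≤ 2.
  C3 : Vector ℤ n → Set
  C3 c = ∀ i → pos i ≤ₙ s (r ∸ 2) →
         ∀ a → suc (ϱ α i) ≤ₙ a → a ≤ₙ r ∸ 1 →
         + s a - + s (ϱ α i) ≤ c i →
         ∀ j → pos j ≡ s a → c j ≤ c i - + s a +ᶻ + s (ϱ α i)

  Cα : Set
  Cα = Σ (Vector ℤ n) λ c → C1 c × C2 c × C3 c

  CPoset : Poset 0ℓ 0ℓ 0ℓ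
  CPoset = On.poset {B = Cα} (≤comp n) proj₁

infix 4 _≅_
_≅_ : {a b c d e f : Level} → Poset a b c → Poset d e f → Set (a ⊔ b ⊔ c ⊔ d ⊔ e ⊔ f)
P ≅ Q = ∃[ f ] IsOrderIsomorphism P._≈_ Q._≈_ P._≤_ Q._≤_ f
  where
  module P = Poset P
  module Q = Poset Q

{-# OPTIONS --safe #-}
module Submission where

-- The code of w is c_i = e_i - s_{ϱ(i)}, where e_i is the last position of the longest run of
-- consecutive positions, starting right after the region of i, at which w takes values below w_i.
-- If w avoids the pattern, then Inv(w) is the transitive closure of these runs, so that weak order
-- is the componentwise order of codes. Conversely, (C2) makes the transitive closure of the runs
-- prescribed by a code cotransitive, hence the inversion set of a permutation, and (C3) prevents
-- the runs of that permutation from being longer than prescribed.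

open import Defs
open import Level using (0ℓ)
open import Data.Nat.Base using (ℕ; zero; suc; _>_; _∸_; z≤n; s≤s; s≤s⁻¹)
  renaming (_+_ to _+ₙ_; _≤_ to _≤ₙ_; _<_ to _<ₙ_)
import Data.Nat.Properties as ℕ
open import Data.Integer.Base using (ℤ; +_; -_; _+_; _-_; _≤_; ∣_∣; +≤+)
import Data.Integer.Properties as ℤ
open import Data.Integer.Tactic.RingSolver using (solve-∀)
open import Data.Fin.Base using (Fin; zero; suc; toℕ; fromℕ<; punchOut; _<_)
  renaming (_≤_ to _≤ᶠ_; _>_ to _>ᶠ_)
import Data.Fin.Properties as Fin
open import Data.Fin.Induction using (Acc; acc; >-wellFounded)
open import Data.Fin.Permutation using (Permutation′; permutation; _⟨$⟩ʳ_; _⟨$⟩ˡ_; inverseˡ; inverseʳ)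
open import Data.Fin.Subset using (Subset; _∈_)
  renaming (∣_∣ to card)
open import Data.Fin.Subset.Properties using (∈⊤; ∣⊤∣≡n; p⊂q⇒∣p∣<∣q∣)
open import Data.List.Base using ([]; _∷_; length; take)
open import Data.List.Relation.Unary.All using (All; []; _∷_)
open import Data.Nat.ListAction using (sum)
open import Data.List.Properties using (take-all)
open import Data.Product.Base using (∃; ∃-syntax; ∃₂; _×_; _,_; proj₁; proj₂)
open import Data.Sum.Base using (_⊎_; inj₁; inj₂; [_,_]′)
open import Data.Vec.Base using (tabulate)
open import Data.Vec.Properties using ([]=⇒lookup; lookup⇒[]=; lookup∘tabulate)
open import Data.Vec.Functional using (Vector)
open import Function.Base using (_∘_; id)
open import Relation.Binary.Bundles using (Poset)
open import Relation.Binary.Construct.Closure.Transitive using (TransClosure; [_]; _∷_; _++_)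
open import Relation.Binary.Core using (Rel)
open import Relation.Binary.Definitions
  using (Decidable; tri<; tri≈; tri>)
open import Relation.Binary.PropositionalEquality
  using (_≡_; _≢_; refl; sym; trans; cong; subst; subst₂)
open import Relation.Nullary using (¬_; Dec; yes; no; does; contradiction; ¬?; _×-dec_; _⊎-dec_; _→-dec_)
open import Relation.Nullary.Decidable using (map′; dec-true)
open import Relation.Unary using (Pred) renaming (Decidable to Decidable₁)

private
  variable
    n : ℕ

-- Permutations from strict total orders

-- Pigeonhole: if `y` were missed, punching it out of the codomain would inject a set into one with
-- fewer elements.
injective⇒surjective : (f : Fin n → Fin n) → (∀ {i j} → f i ≡ f j → i ≡ j) →
                       ∀ y → ∃[ x ] f x ≡ y
injective⇒surjective {suc n} f inj y with Fin.any? (λ x → f x Fin.≟ y)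
... | yes hit = hit
... | no miss = contradiction (Fin.injective⇒≤ {f = λ x → punchOut (y≢f x)}
                  (λ {i} {j} eq → inj (Fin.punchOut-injective (y≢f i) (y≢f j) eq)))
                  ℕ.1+n≰n
  where
  y≢f : ∀ x → y ≢ f x
  y≢f x y≡fx = miss (x , sym y≡fx)

module _ {P : Pred (Fin n) 0ℓ} (P? : Decidable₁ P) where

  filterSubset : Subset n
  filterSubset = tabulate (does ∘ P?)

  ∈-filter⁺ : ∀ {i} → P i → i ∈ filterSubset
  ∈-filter⁺ {i} p = lookup⇒[]= i _ (trans (lookup∘tabulate _ i) (dec-true (P? i) p))

  ∈-filter⁻ : ∀ {i} → i ∈ filterSubset → P i
  ∈-filter⁻ {i} i∈ with P? i | trans (sym (lookup∘tabulate (does ∘ P?) i)) ([]=⇒lookup i∈)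
  ... | yes p | _ = p

module _ {_≺_ : Rel (Fin n) 0ℓ} (_≺?_ : Decidable _≺_)
         (irrefl : ∀ {i} → ¬ i ≺ i) (≺-trans : ∀ {i j k} → i ≺ j → j ≺ k → i ≺ k)
         (total : ∀ i j → i ≢ j → i ≺ j ⊎ j ≺ i) where

  -- Each element is sent to the number of its predecessors. If `i ≺ j`, the predecessors of `j`
  -- include those of `i` and also `i` itself, so ranks increase strictly; totality then makes them
  -- distinct.
  strictTotalOrder⇒permutation : ∃[ w ] (∀ {i j} → i ≺ j → (w ⟨$⟩ʳ i) < (w ⟨$⟩ʳ j))
  strictTotalOrder⇒permutation =
    permutation rank (proj₁ ∘ surj) (proj₂ ∘ surj) (λ i → inj (proj₂ (surj (rank i)))) , mono
    where
    below : Fin n → Subset n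
    below i = filterSubset (_≺? i)

    i∉below : ∀ i → ¬ i ∈ below i
    i∉below i i∈ = irrefl (∈-filter⁻ (_≺? i) i∈)

    rank< : ∀ i → card (below i) <ₙ n
    rank< i = subst (card (below i) <ₙ_) (∣⊤∣≡n n)
                (p⊂q⇒∣p∣<∣q∣ ((λ _ → ∈⊤) , i , ∈⊤ , i∉below i))

    rank : Fin n → Fin n
    rank i = fromℕ< (rank< i)

    mono : ∀ {i j} → i ≺ j → rank i < rank j
    mono {i} {j} i≺j = subst₂ _<ₙ_ (sym (Fin.toℕ-fromℕ< _)) (sym (Fin.toℕ-fromℕ< _))
      (p⊂q⇒∣p∣<∣q∣
        ( (λ x∈ → ∈-filter⁺ (_≺? j) (≺-trans (∈-filter⁻ (_≺? i) x∈) i≺j))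
        , i , ∈-filter⁺ (_≺? j) i≺j , i∉below i))

    inj : ∀ {i j} → rank i ≡ rank j → i ≡ j
    inj {i} {j} eq with i Fin.≟ j
    ... | yes i≡j = i≡j
    ... | no  i≢j = contradiction eq
      ([ Fin.<⇒≢ ∘ mono , (λ j≺i eq → Fin.<⇒≢ (mono j≺i) (sym eq)) ]′ (total i j i≢j))

    surj : ∀ y → ∃[ x ] rank x ≡ y
    surj = injective⇒surjective rank inj

module _ {I : Rel (Fin n) 0ℓ} (I? : Decidable I) (I⇒< : ∀ {i j} → I i j → i < j)
         (I-trans : ∀ {i j k} → I i j → I j k → I i k)
         (I-cotrans : ∀ {i j k} → i < j → j < k → I i k → I i j ⊎ I j k) where

  -- Let `i ≺ j` say that position `i` must receive the smaller value. Each way of composing two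
  -- such constraints is settled by transitivity or cotransitivity of `I`, so `≺` is a strict total
  -- order and its rank function is the permutation.
  realize-inversions : ∃[ w ] (∀ {i j} → I i j → (w ⟨$⟩ʳ j) < (w ⟨$⟩ʳ i)) ×
                              (∀ {i j} → i < j → ¬ I i j → (w ⟨$⟩ʳ i) < (w ⟨$⟩ʳ j))
  realize-inversions = let w , mono = strictTotalOrder⇒permutation ≺? irrefl ≺-trans total in
    w , (λ Iij → mono (inj₂ (I⇒< Iij , Iij))) , (λ i<j ¬Iij → mono (inj₁ (i<j , ¬Iij)))
    where
    _≺_ : Rel (Fin n) 0ℓ
    i ≺ j = (i < j × ¬ I i j) ⊎ (j < i × I j i)

    ≺? : Decidable _≺_
    ≺? i j = ((i Fin.<? j) ×-dec ¬? (I? i j)) ⊎-dec ((j Fin.<? i) ×-dec I? j i)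

    irrefl : ∀ {i} → ¬ i ≺ i
    irrefl (inj₁ (i<i , _)) = Fin.<-irrefl refl i<i
    irrefl (inj₂ (i<i , _)) = Fin.<-irrefl refl i<i

    ≺-trans : ∀ {i j k} → i ≺ j → j ≺ k → i ≺ k
    ≺-trans (inj₁ (i<j , ¬ij)) (inj₁ (j<k , ¬jk)) =
      inj₁ (Fin.<-trans i<j j<k , λ ik → [ ¬ij , ¬jk ]′ (I-cotrans i<j j<k ik))
    ≺-trans {i} {j} {k} (inj₁ (i<j , ¬ij)) (inj₂ (k<j , kj)) with Fin.<-cmp i k
    ... | tri< i<k _ _  = inj₁ (i<k , λ ik → ¬ij (I-trans ik kj))
    ... | tri≈ _ refl _ = contradiction kj ¬ij
    ... | tri> _ _ k<i  = inj₂ (k<i , [ id , (λ ij → contradiction ij ¬ij) ]′ (I-cotrans k<i i<j kj))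
    ≺-trans {i} {j} {k} (inj₂ (j<i , ji)) (inj₁ (j<k , ¬jk)) with Fin.<-cmp i k
    ... | tri< i<k _ _  = inj₁ (i<k , λ ik → ¬jk (I-trans ji ik))
    ... | tri≈ _ refl _ = contradiction ji ¬jk
    ... | tri> _ _ k<i  = inj₂ (k<i , [ (λ jk → contradiction jk ¬jk) , id ]′ (I-cotrans j<k k<i ji))
    ≺-trans (inj₂ (j<i , ji)) (inj₂ (k<j , kj)) = inj₂ (Fin.<-trans k<j j<i , I-trans kj ji)

    total : ∀ i j → i ≢ j → i ≺ j ⊎ j ≺ i
    total i j i≢j with Fin.<-cmp i j
    ... | tri≈ _ i≡j _ = contradiction i≡j i≢j
    ... | tri< i<j _ _ with I? i j
    ...   | yes ij = inj₂ (inj₂ (i<j , ij))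
    ...   | no ¬ij = inj₁ (inj₁ (i<j , ¬ij))
    total i j i≢j | tri> _ _ j<i with I? j i
    ...   | yes ji = inj₁ (inj₂ (j<i , ji))
    ...   | no ¬ji = inj₂ (inj₁ (j<i , ¬ji))

-- Consecutive values of a permutation, and first failures

⟨$⟩ʳ-injective : (w : Permutation′ n) → ∀ {i j} → w ⟨$⟩ʳ i ≡ w ⟨$⟩ʳ j → i ≡ j
⟨$⟩ʳ-injective w eq = trans (sym (inverseˡ w)) (trans (cong (w ⟨$⟩ˡ_) eq) (inverseˡ w))

next-value : (w : Permutation′ n) → ∀ {i k} → (w ⟨$⟩ʳ k) < (w ⟨$⟩ʳ i) →
             ∃[ x ] toℕ (w ⟨$⟩ʳ x) ≡ suc (toℕ (w ⟨$⟩ʳ k))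
next-value w {i} wk<wi = w ⟨$⟩ˡ fromℕ< v<n , trans (cong toℕ (inverseʳ w)) (Fin.toℕ-fromℕ< v<n)
  where v<n = ℕ.≤-<-trans wk<wi (Fin.toℕ<n (w ⟨$⟩ʳ i))

-- A discrete intermediate value argument: climbing from `w k` to `w i` one value at a time, `Q`
-- must be lost at some step. The number `d` of values still to climb drives the induction.
value-crossing : (w : Permutation′ n) {Q : Pred (Fin n) 0ℓ} → Decidable₁ Q →
                 ∀ d {i k} → d +ₙ toℕ (w ⟨$⟩ʳ k) ≡ toℕ (w ⟨$⟩ʳ i) → Q k → ¬ Q i →
                 ∃₂ λ q l → ¬ Q q × Q l × toℕ (w ⟨$⟩ʳ q) ≡ suc (toℕ (w ⟨$⟩ʳ l)) ×
                            (w ⟨$⟩ʳ k) ≤ᶠ (w ⟨$⟩ʳ l) × (w ⟨$⟩ʳ q) ≤ᶠ (w ⟨$⟩ʳ i)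
value-crossing w {Q} Q? zero eq Qk ¬Qi =
  contradiction (subst Q (⟨$⟩ʳ-injective w (Fin.toℕ-injective eq)) Qk) ¬Qi
value-crossing w Q? (suc d) {i} {k} eq Qk ¬Qi
  with x , wx≡ ← next-value w {i} {k} (subst (toℕ (w ⟨$⟩ʳ k) <ₙ_) eq (s≤s (ℕ.m≤n+m _ d)))
  with Q? x
... | no ¬Qx = x , k , ¬Qx , Qk , wx≡ , ℕ.≤-refl ,
               subst₂ _≤ₙ_ (sym wx≡) eq (s≤s (ℕ.m≤n+m _ d))
... | yes Qx
  with q , l , ¬Qq , Ql , wq≡ , x≤l , q≤i ←
         value-crossing w Q? d (trans (cong (d +ₙ_) wx≡) (trans (ℕ.+-suc d _) eq)) Qx ¬Qi
  = q , l , ¬Qq , Ql , wq≡ , ℕ.≤-trans (ℕ.n≤1+n _) (subst (_≤ₙ toℕ (w ⟨$⟩ʳ l)) wx≡ x≤l) , q≤i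

least-failure : {P : Pred (Fin n) 0ℓ} → Decidable₁ P →
                (∀ i → P i) ⊎ ∃[ i ] ¬ P i × (∀ j → j < i → P j)
least-failure {zero}  P? = inj₁ λ ()
least-failure {suc n} P? with P? zero
... | no ¬p0 = inj₂ (zero , ¬p0 , λ _ ())
... | yes p0 with least-failure (P? ∘ suc)
...   | inj₁ all             = inj₁ λ { zero → p0 ; (suc i) → all i }
...   | inj₂ (i , ¬pi , min) = inj₂ (suc i , ¬pi , λ { zero _ → p0 ; (suc j) (s≤s j<i) → min j j<i })

-- Monotonicity of partial sums

sum-take-mono : ∀ ps {a b} → a ≤ₙ b → sum (take a ps) ≤ₙ sum (take b ps)
sum-take-mono _        z≤n       = z≤n
sum-take-mono []       (s≤s _)   = z≤n
sum-take-mono (p ∷ ps) (s≤s a≤b) = ℕ.+-monoʳ-≤ p (sum-take-mono ps a≤b)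

sum-take-strict : ∀ {ps} → All (0 <ₙ_) ps → ∀ {a b} → a <ₙ b → b ≤ₙ length ps →
                  sum (take a ps) <ₙ sum (take b ps)
sum-take-strict (0<p ∷ _)  {zero}  (s≤s _)   (s≤s _)   = ℕ.≤-trans 0<p (ℕ.m≤m+n _ _)
sum-take-strict (_ ∷ 0<ps) {suc _} (s≤s a<b) (s≤s b≤r) = ℕ.+-monoʳ-< _ (sum-take-strict 0<ps a<b b≤r)

-- Inequalities between integers with all subtractions cleared

+-cancelʳ-≤ : ∀ k {i j} → i + k ≤ j + k → i ≤ j
+-cancelʳ-≤ k {i} {j} le = subst₂ _≤_ (cancel i k) (cancel j k) (ℤ.+-monoˡ-≤ (- k) le)
  where
  cancel : ∀ i k → i + k + - k ≡ i
  cancel = solve-∀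

private
  i-j+j : ∀ i j → i - j + j ≡ i
  i-j+j = solve-∀

  i-j+k+j : ∀ i j k → i - j + k + j ≡ i + k
  i-j+k+j = solve-∀

-‿≤⁺ : ∀ {a b c} → a ≤ₙ c +ₙ b → + a - + b ≤ + c
-‿≤⁺ {a} {b} {c} le = +-cancelʳ-≤ (+ b)
  (subst (_≤ + c + + b) (sym (i-j+j (+ a) (+ b))) (+≤+ le))

-‿≤⁻ : ∀ {a b c} → + a - + b ≤ + c → a ≤ₙ c +ₙ b
-‿≤⁻ {a} {b} {c} le = ℤ.drop‿+≤+ (subst (_≤ + c + + b) (i-j+j (+ a) (+ b)) (ℤ.+-monoˡ-≤ (+ b) le))

≤-‿⁺ : ∀ {a b c} → c +ₙ b ≤ₙ a → + c ≤ + a - + b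
≤-‿⁺ {a} {b} {c} le = +-cancelʳ-≤ (+ b)
  (subst (+ c + + b ≤_) (sym (i-j+j (+ a) (+ b))) (+≤+ le))

≤-‿⁻ : ∀ {a b c} → + c ≤ + a - + b → c +ₙ b ≤ₙ a
≤-‿⁻ {a} {b} {c} le = ℤ.drop‿+≤+ (subst (+ c + + b ≤_) (i-j+j (+ a) (+ b)) (ℤ.+-monoˡ-≤ (+ b) le))

≤-‿+⁺ : ∀ {a b c d} → d +ₙ a ≤ₙ c +ₙ b → + d ≤ + c - + a + + b
≤-‿+⁺ {a} {b} {c} {d} le = +-cancelʳ-≤ (+ a)
  (subst (+ d + + a ≤_) (sym (i-j+k+j (+ c) (+ a) (+ b))) (+≤+ le))

≤-‿+⁻ : ∀ {a b c d} → + d ≤ + c - + a + + b → d +ₙ a ≤ₙ c +ₙ b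
≤-‿+⁻ {a} {b} {c} {d} le = ℤ.drop‿+≤+
  (subst (+ d + + a ≤_) (i-j+k+j (+ c) (+ a) (+ b)) (ℤ.+-monoˡ-≤ (+ a) le))

module _ (α : Composition n) where
  open Composition α

  -- Regions

  end : Fin n → ℕ
  end i = s (ϱ α i)

  s-mono : ∀ {a b} → a ≤ₙ b → s a ≤ₙ s b
  s-mono = sum-take-mono parts

  s-r : s r ≡ n
  s-r = trans (cong sum (take-all r parts ℕ.≤-refl)) total

  ϱ≤r : ∀ i → ϱ α i ≤ₙ r
  ϱ≤r i = proj₂ (proj₁ (ϱ-spec α i))

  pos≤end : ∀ i → pos i ≤ₙ end i
  pos≤end i = proj₂ (proj₂ (ϱ-spec α i))

  start<pos : ∀ i → s (ϱ α i ∸ 1) <ₙ pos i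
  start<pos i = proj₁ (proj₂ (ϱ-spec α i))

  end≤n : ∀ i → end i ≤ₙ n
  end≤n i = subst (end i ≤ₙ_) s-r (s-mono (ϱ≤r i))

  end<pos⇒ϱ<ϱ : ∀ {i j} → end i <ₙ pos j → ϱ α i <ₙ ϱ α j
  end<pos⇒ϱ<ϱ {i} {j} end<pos =
    ℕ.≰⇒> λ ϱj≤ϱi → ℕ.<⇒≱ end<pos (ℕ.≤-trans (pos≤end j) (s-mono ϱj≤ϱi))

  ϱ<ϱ⇒end<pos : ∀ {i j} → ϱ α i <ₙ ϱ α j → end i <ₙ pos j
  ϱ<ϱ⇒end<pos {i} {j} lt = ℕ.≤-<-trans (s-mono (ℕ.∸-monoˡ-≤ 1 lt)) (start<pos j)

  end<pos⇒< : ∀ {i j : Fin n} → end i <ₙ pos j → i < j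
  end<pos⇒< {i} lt = s≤s⁻¹ (ℕ.≤-<-trans (pos≤end i) lt)

  ϱ<ϱ⇒< : ∀ {i j} → ϱ α i <ₙ ϱ α j → i < j
  ϱ<ϱ⇒< = end<pos⇒< ∘ ϱ<ϱ⇒end<pos

  ϱ-mono : ∀ {i j} → i ≤ᶠ j → ϱ α i ≤ₙ ϱ α j
  ϱ-mono i≤j = ℕ.≮⇒≥ λ lt → ℕ.<⇒≱ (ϱ<ϱ⇒< lt) i≤j

  at-position : ∀ {m} → 0 <ₙ m → m ≤ₙ n → ∃ λ (i : Fin n) → pos i ≡ m
  at-position {suc m} _ m<n = fromℕ< m<n , cong suc (Fin.toℕ-fromℕ< m<n)

  last-of-region : ∀ i → ∃ λ (j : Fin n) → pos j ≡ end i × ϱ α j ≡ ϱ α i × i ≤ᶠ j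
  last-of-region i with j , pos-j ← at-position (ℕ.≤-trans (s≤s z≤n) (pos≤end i)) (end≤n i) =
    j , pos-j , ℕ.≤-antisym (ℕ.≮⇒≥ λ lt → ℕ.<-irrefl (sym pos-j) (ϱ<ϱ⇒end<pos lt)) (ϱ-mono {i} {j} i≤j) , i≤j
    where
    i≤j : i ≤ᶠ j
    i≤j = s≤s⁻¹ (subst (pos i ≤ₙ_) (sym pos-j) (pos≤end i))

  -- The ends are compared directly: the region of `j` starts before `s a`, hence has index at most
  -- `a`, while `pos j` itself is at most `end j`.
  end-at : ∀ {a} {j : Fin n} → pos j ≡ s a → end j ≡ s a
  end-at {a} {j} pos-j = ℕ.≤-antisym (s-mono ϱj≤a) (subst (_≤ₙ end j) pos-j (pos≤end j))
    where
    ϱj∸1<a : ϱ α j ∸ 1 <ₙ a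
    ϱj∸1<a = ℕ.≰⇒> λ le → ℕ.<⇒≱ (start<pos j) (subst (_≤ₙ s (ϱ α j ∸ 1)) (sym pos-j) (s-mono le))
    ϱj≤a : ϱ α j ≤ₙ a
    ϱj≤a = ℕ.≤-trans (ℕ.m≤n+m∸n (ϱ α j) 1) ϱj∸1<a

  -- Extends conditions on adjacent positions, such as (C2) or membership in `InSα`, to all pairs of
  -- a region; positions between two members lie in the same region because `ϱ` is monotone.
  region-chain : {R : Rel (Fin n) 0ℓ} → (∀ {i j k} → R i j → R j k → R i k) →
                 (∀ i j → pos j ≡ suc (pos i) → ϱ α i ≡ ϱ α j → R i j) →
                 ∀ {i j} → i < j → ϱ α i ≡ ϱ α j → R i j
  region-chain {R} R-trans step {i} {j} i<j =
    go (toℕ j ∸ pos i) i j (cong suc (sym (ℕ.m∸n+n≡m i<j)))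
    where
    go : ∀ d i j → pos j ≡ suc (d +ₙ pos i) → ϱ α i ≡ ϱ α j → R i j
    go zero    i j eq ϱ≡ = step i j eq ϱ≡
    go (suc d) i j eq ϱ≡ = R-trans (step i k pos-k ϱi≡ϱk)
        (go d k j (trans eq (cong suc (trans (sym (ℕ.+-suc d (pos i))) (cong (d +ₙ_) (sym pos-k)))))
          (trans (sym ϱi≡ϱk) ϱ≡))
      where
      k<j : suc (pos i) <ₙ pos j
      k<j = subst (suc (pos i) <ₙ_) (sym eq) (s≤s (s≤s (ℕ.m≤n+m (pos i) d)))
      next : ∃ λ (k : Fin n) → pos k ≡ suc (pos i)
      next = at-position (s≤s z≤n) (ℕ.≤-trans (ℕ.<⇒≤ k<j) (Fin.toℕ<n j))
      k = proj₁ next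
      pos-k = proj₂ next
      i≤k : i ≤ᶠ k
      i≤k = s≤s⁻¹ (subst (pos i ≤ₙ_) (sym pos-k) (ℕ.n≤1+n _))
      k≤j : k ≤ᶠ j
      k≤j = s≤s⁻¹ (subst (_≤ₙ pos j) (sym pos-k) (ℕ.<⇒≤ k<j))
      ϱi≡ϱk : ϱ α i ≡ ϱ α k
      ϱi≡ϱk = ℕ.≤-antisym (ϱ-mono {i} {k} i≤k) (subst (ϱ α k ≤ₙ_) (sym ϱ≡) (ϱ-mono {k} {j} k≤j))

  -- Conditions (C1)–(C3) in terms of e i = s_{ϱ(i)} + c_i

  record Admissible (e : Fin n → ℕ) : Set where
    field
      end≤e  : ∀ i → end i ≤ₙ e i
      e≤n    : ∀ i → e i ≤ₙ n
      e-mono : ∀ {i j} → ϱ α i ≡ ϱ α j → i ≤ᶠ j → e i ≤ₙ e j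
      nested : ∀ {i j} → ϱ α i <ₙ ϱ α j → end j ≤ₙ e i → e j ≤ₙ e i

  -- For admissible `e` the truncated subtraction is exact, since `end i ≤ e i`. Likewise the
  -- absolute value in `decode` changes nothing under (C1).
  code : (Fin n → ℕ) → Vector ℤ n
  code e i = + (e i ∸ end i)

  decode : Vector ℤ n → Fin n → ℕ
  decode c i = ∣ c i ∣ +ₙ end i

  code∈Cα : ∀ {e} → Admissible e → C1 α (code e) × C2 α (code e) × C3 α (code e)
  code∈Cα {e} adm = c1 , c2 , c3
    where
    open Admissible adm

    restore : ∀ i → e i ∸ end i +ₙ end i ≡ e i
    restore i = ℕ.m∸n+n≡m (end≤e i)

    c1 : C1 α (code e)
    c1 i = +≤+ z≤n , ≤-‿⁺ (subst (_≤ₙ n) (sym (restore i)) (e≤n i))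

    c2 : C2 α (code e)
    c2 i j pos-j ϱ≡ = +≤+ (subst (λ x → e i ∸ end i ≤ₙ e j ∸ x) (cong s ϱ≡)
      (ℕ.∸-monoˡ-≤ (end i) (e-mono ϱ≡ (s≤s⁻¹ (subst (pos i ≤ₙ_) (sym pos-j) (ℕ.n≤1+n _))))))

    c3 : C3 α (code e)
    c3 i _ a ϱi<a a≤r∸1 s-a≤ j pos-j = ≤-‿+⁺ {d = e j ∸ end j}
      (subst₂ _≤ₙ_ (sym (trans (cong (e j ∸ end j +ₙ_) (sym end-j)) (restore j))) (sym (restore i))
        (nested (end<pos⇒ϱ<ϱ end-i<j) end-j≤e))
      where
      end-j : end j ≡ s a
      end-j = end-at {a} pos-j
      end-j≤e : end j ≤ₙ e i
      end-j≤e = subst₂ _≤ₙ_ (sym end-j) (restore i) (-‿≤⁻ s-a≤)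
      end-i<j : end i <ₙ pos j
      end-i<j = subst (end i <ₙ_) (sym pos-j)
        (sum-take-strict positive ϱi<a (ℕ.≤-trans a≤r∸1 (ℕ.m∸n≤m r 1)))

  decode-admissible : ∀ {c} → C1 α c → C2 α c → C3 α c → Admissible (decode c)
  decode-admissible {c} c1 c2 c3 = record
    { end≤e  = λ i → ℕ.m≤n+m (end i) ∣ c i ∣
    ; e≤n    = bound
    ; e-mono = mono
    ; nested = nested
    }
    where
    +∣c∣≡c : ∀ i → + ∣ c i ∣ ≡ c i
    +∣c∣≡c i = ℤ.0≤i⇒+∣i∣≡i (proj₁ (c1 i))

    bound : ∀ i → decode c i ≤ₙ n
    bound i = ≤-‿⁻ (subst (_≤ + n - + end i) (sym (+∣c∣≡c i)) (proj₂ (c1 i)))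

    c-mono : ∀ {i j} → ϱ α i ≡ ϱ α j → i ≤ᶠ j → c i ≤ c j
    c-mono {i} {j} ϱ≡ i≤j with ℕ.m≤n⇒m<n∨m≡n i≤j
    ... | inj₁ i<j = region-chain {R = λ i j → c i ≤ c j} ℤ.≤-trans c2 i<j ϱ≡
    ... | inj₂ i≡j = ℤ.≤-reflexive (cong c (Fin.toℕ-injective i≡j))

    mono : ∀ {i j} → ϱ α i ≡ ϱ α j → i ≤ᶠ j → decode c i ≤ₙ decode c j
    mono {i} {j} ϱ≡ i≤j = ℕ.+-mono-≤
      (ℤ.drop‿+≤+ (subst₂ _≤_ (sym (+∣c∣≡c i)) (sym (+∣c∣≡c j)) (c-mono ϱ≡ i≤j)))
      (ℕ.≤-reflexive (cong s ϱ≡))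

    nested : ∀ {i j} → ϱ α i <ₙ ϱ α j → end j ≤ₙ decode c i → decode c j ≤ₙ decode c i
    nested {i} {j} ϱi<ϱj end-j≤ with ϱ α j ℕ.≤? r ∸ 1 | last-of-region j
    -- Here `j` lies in the last region, which ends at `n`, so the bound by `n` suffices.
    ... | no  ϱj≰ | _ = ℕ.≤-trans (bound j) (ℕ.≤-trans n≤end-j end-j≤)
      where
      n≤end-j : n ≤ₙ end j
      n≤end-j = subst (_≤ₙ end j) s-r (s-mono (ℕ.≤-trans (ℕ.m≤n+m∸n r 1) (ℕ.≰⇒> ϱj≰)))
    -- (C3) only speaks of the last position `t` of a region; monotonicity within the region passes
    -- the bound from `t` to `j`.
    ... | yes ϱj≤ | t , pos-t , ϱt≡ϱj , j≤t = ℕ.≤-trans (mono (sym ϱt≡ϱj) j≤t)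
        (subst (λ x → ∣ c t ∣ +ₙ x ≤ₙ decode c i) (cong s (sym ϱt≡ϱj)) (≤-‿+⁻ c-t≤))
      where
      -- The range of `i` in (C3) is automatic: `ϱ α i` is smaller than `ϱ α j`, which is at most
      -- `r ∸ 1`.
      i≤s : pos i ≤ₙ s (r ∸ 2)
      i≤s = ℕ.≤-trans (pos≤end i)
        (s-mono (subst (ϱ α i ≤ₙ_) (ℕ.∸-+-assoc r 1 1) (ℕ.∸-monoˡ-≤ 1 (ℕ.≤-trans ϱi<ϱj ϱj≤))))
      c-t≤ : + ∣ c t ∣ ≤ + ∣ c i ∣ - + end j + + end i
      c-t≤ = subst₂ (λ x y → x ≤ y - + end j + + end i) (sym (+∣c∣≡c t)) (sym (+∣c∣≡c i))
        (c3 i i≤s (ϱ α j) ϱi<ϱj ϱj≤ (subst (+ end j - + end i ≤_) (+∣c∣≡c i) (-‿≤⁺ end-j≤)) t pos-t)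

  -- Runs of inversions

  -- An empty run has `e` equal to `end i`; when `e` is `n`, no position follows and `outside` is
  -- vacuous.
  record IsRunEnd (w : Permutation′ n) (i : Fin n) (e : ℕ) : Set where
    field
      end≤    : end i ≤ₙ e
      ≤n      : e ≤ₙ n
      inside  : ∀ k → end i <ₙ pos k → pos k ≤ₙ e → (w ⟨$⟩ʳ k) < (w ⟨$⟩ʳ i)
      outside : ∀ k → pos k ≡ suc e → ¬ (w ⟨$⟩ʳ k) < (w ⟨$⟩ʳ i)

  open IsRunEnd

  run-end : ∀ w i → ∃ (IsRunEnd w i)
  run-end w i
    with least-failure (λ k → (end i ℕ.<? pos k) →-dec ((w ⟨$⟩ʳ k) Fin.<? (w ⟨$⟩ʳ i)))
  ... | inj₁ all = n , record
    { end≤    = end≤n i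
    ; ≤n      = ℕ.≤-refl
    ; inside  = λ k lt _ → all k lt
    ; outside = λ k eq → contradiction (subst (_≤ₙ n) eq (Fin.toℕ<n k)) ℕ.1+n≰n
    }
  -- As `pos k` is `suc (toℕ k)`, the number `toℕ k` is the position just before the first failure.
  ... | inj₂ (k , fail , below) = toℕ k , record
    { end≤    = s≤s⁻¹ (ℕ.≰⇒> λ k≤end → fail λ end<k → contradiction k≤end (ℕ.<⇒≱ end<k))
    ; ≤n      = ℕ.<⇒≤ (Fin.toℕ<n k)
    ; inside  = λ j lt j<k → below j j<k lt
    ; outside = λ j eq lt → fail λ _ →
        subst (λ x → (w ⟨$⟩ʳ x) < (w ⟨$⟩ʳ i)) (Fin.toℕ-injective (ℕ.suc-injective eq)) lt
    }

  runEnd : Permutation′ n → Fin n → ℕ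
  runEnd w i = proj₁ (run-end w i)

  runEnd-spec : ∀ w i → IsRunEnd w i (runEnd w i)
  runEnd-spec w i = proj₂ (run-end w i)

  -- A longer stretch of smaller values would contain position `e + 1`, against `outside`.
  IsRunEnd-maximal : ∀ {w i e m} → IsRunEnd w i e → m ≤ₙ n →
                     (∀ k → end i <ₙ pos k → pos k ≤ₙ m → (w ⟨$⟩ʳ k) < (w ⟨$⟩ʳ i)) → m ≤ₙ e
  IsRunEnd-maximal {w} {i} {e} {m} run m≤n inverted = ℕ.≮⇒≥ λ e<m →
    let k , pos-k = at-position (s≤s z≤n) (ℕ.≤-trans e<m m≤n) in
    outside run k pos-k (inverted k
      (subst (end i <ₙ_) (sym pos-k) (s≤s (end≤ run)))
      (subst (_≤ₙ m) (sym pos-k) e<m))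

  IsRunEnd-unique : ∀ {w i e f} → IsRunEnd w i e → IsRunEnd w i f → e ≡ f
  IsRunEnd-unique re rf = ℕ.≤-antisym
    (IsRunEnd-maximal rf (≤n re) (inside re)) (IsRunEnd-maximal re (≤n rf) (inside rf))

  runEnd-monotone : ∀ {u v} → u ≤L v → ∀ i → runEnd u i ≤ₙ runEnd v i
  runEnd-monotone {u} {v} u≤v i = IsRunEnd-maximal (runEnd-spec v i) (≤n (runEnd-spec u i))
    λ k end<k k≤e → proj₂ (u≤v (i , k) (end<pos⇒< end<k , inside (runEnd-spec u i) k end<k k≤e))

  InSα⇒increasing : ∀ {w} → InSα α w → ∀ {i j} → i < j → ϱ α i ≡ ϱ α j → (w ⟨$⟩ʳ i) < (w ⟨$⟩ʳ j)
  InSα⇒increasing {w} inSα = region-chain {R = λ i j → (w ⟨$⟩ʳ i) < (w ⟨$⟩ʳ j)} Fin.<-trans inSα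

  -- Within a region `w` increases, so a later position dominates whatever an earlier one does. If
  -- the run of `i` covers the region of `j`, then `w j` is below `w i`, and the run of `j` would
  -- prolong that of `i`.
  runEnd-admissible : ∀ {w} → InSα α w → Admissible (runEnd w)
  runEnd-admissible {w} inSα = record
    { end≤e  = λ i → end≤ (runEnd-spec w i)
    ; e≤n    = λ i → ≤n (runEnd-spec w i)
    ; e-mono = mono
    ; nested = nested
    }
    where
    mono : ∀ {i j} → ϱ α i ≡ ϱ α j → i ≤ᶠ j → runEnd w i ≤ₙ runEnd w j
    mono {i} {j} ϱ≡ i≤j = IsRunEnd-maximal (runEnd-spec w j) (≤n (runEnd-spec w i))
      λ k end<k k≤e → ℕ.<-≤-trans
        (inside (runEnd-spec w i) k (subst (_<ₙ pos k) (cong s (sym ϱ≡)) end<k) k≤e) wi≤wj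
      where
      wi≤wj : (w ⟨$⟩ʳ i) ≤ᶠ (w ⟨$⟩ʳ j)
      wi≤wj with ℕ.m≤n⇒m<n∨m≡n i≤j
      ... | inj₁ i<j = ℕ.<⇒≤ (InSα⇒increasing {w} inSα i<j ϱ≡)
      ... | inj₂ i≡j = ℕ.≤-reflexive (cong (λ x → toℕ (w ⟨$⟩ʳ x)) (Fin.toℕ-injective i≡j))

    nested : ∀ {i j} → ϱ α i <ₙ ϱ α j → end j ≤ₙ runEnd w i → runEnd w j ≤ₙ runEnd w i
    nested {i} {j} ϱi<ϱj end-j≤e = IsRunEnd-maximal (runEnd-spec w i) (≤n (runEnd-spec w j)) inverted
      where
      wj<wi : (w ⟨$⟩ʳ j) < (w ⟨$⟩ʳ i)
      wj<wi = inside (runEnd-spec w i) j (ϱ<ϱ⇒end<pos ϱi<ϱj) (ℕ.≤-trans (pos≤end j) end-j≤e)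
      inverted : ∀ k → end i <ₙ pos k → pos k ≤ₙ runEnd w j → (w ⟨$⟩ʳ k) < (w ⟨$⟩ʳ i)
      inverted k end<k k≤ with pos k ℕ.≤? runEnd w i
      ... | yes k≤e = inside (runEnd-spec w i) k end<k k≤e
      ... | no  k≰e = Fin.<-trans
        (inside (runEnd-spec w j) k (ℕ.≤-<-trans end-j≤e (ℕ.≰⇒> k≰e)) k≤) wj<wi

  -- The inversions generated by the runs

  Run : (Fin n → ℕ) → Rel (Fin n) 0ℓ
  Run e i k = end i <ₙ pos k × pos k ≤ₙ e i

  Reach : (Fin n → ℕ) → Rel (Fin n) 0ℓ
  Reach e = TransClosure (Run e)

  Run? : ∀ e → Decidable (Run e)
  Run? e i k = (end i ℕ.<? pos k) ×-dec (pos k ℕ.≤? e i)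

  Reach⇒ϱ<ϱ : ∀ {e i k} → Reach e i k → ϱ α i <ₙ ϱ α k
  Reach⇒ϱ<ϱ [ end<k , _ ]       = end<pos⇒ϱ<ϱ end<k
  Reach⇒ϱ<ϱ ((end<q , _) ∷ q→k) = ℕ.<-trans (end<pos⇒ϱ<ϱ end<q) (Reach⇒ϱ<ϱ q→k)

  -- Every run leads strictly to the right, so searching over the first step of a chain terminates.
  Reach? : ∀ e → Decidable (Reach e)
  Reach? e i k = go (>-wellFounded i)
    where
    go : ∀ {i} → Acc _>ᶠ_ i → Dec (Reach e i k)
    go {i} (acc rec) = map′ join split (Run? e i k ⊎-dec Fin.any? via?)
      where
      Via : Fin n → Set
      Via q = Run e i q × Reach e q k
      via? : Decidable₁ Via
      via? q with Run? e i q
      ... | no ¬run = no (¬run ∘ proj₁)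
      ... | yes run = map′ (run ,_) proj₂ (go (rec (end<pos⇒< (proj₁ run))))
      join : Run e i k ⊎ ∃ Via → Reach e i k
      join = [ [_] , (λ (_ , run , q→k) → run ∷ q→k) ]′
      split : Reach e i k → Run e i k ⊎ ∃ Via
      split [ run ]       = inj₁ run
      split (run ∷ q→k) = inj₂ (_ , run , q→k)

  Reach-monotone : ∀ {e f} → (∀ i → e i ≤ₙ f i) → ∀ {i k} → Reach e i k → Reach f i k
  Reach-monotone e≤f [ end<k , k≤e ]       = [ end<k , ℕ.≤-trans k≤e (e≤f _) ]
  Reach-monotone e≤f ((end<q , q≤e) ∷ q→k) = (end<q , ℕ.≤-trans q≤e (e≤f _)) ∷ Reach-monotone e≤f q→k

  Reach⇒inverted : ∀ {w e} → (∀ i → IsRunEnd w i (e i)) →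
                   ∀ {i k} → Reach e i k → (w ⟨$⟩ʳ k) < (w ⟨$⟩ʳ i)
  Reach⇒inverted runs [ end<k , k≤e ]       = inside (runs _) _ end<k k≤e
  Reach⇒inverted runs ((end<q , q≤e) ∷ q→k) =
    Fin.<-trans (Reach⇒inverted runs q→k) (inside (runs _) _ end<q q≤e)

  -- Walking up the values from w k to w i, the first position not to the right of the region
  -- of p must lie in that region, for otherwise it would complete a forbidden pattern with p.
  intermediate-in-region :
    ∀ {w} → ¬ Has231 α w → ∀ {i p k} → ϱ α i <ₙ ϱ α p → ϱ α p <ₙ ϱ α k →
    (w ⟨$⟩ʳ k) < (w ⟨$⟩ʳ i) → (w ⟨$⟩ʳ i) < (w ⟨$⟩ʳ p) →
    ∃[ q ] ϱ α q ≡ ϱ α p × (w ⟨$⟩ʳ k) < (w ⟨$⟩ʳ q) × (w ⟨$⟩ʳ q) < (w ⟨$⟩ʳ p)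
  intermediate-in-region {w} no231 {i} {p} {k} ϱi<ϱp ϱp<ϱk wk<wi wi<wp
    with q , l , ϱp≮ϱq , ϱp<ϱl , wq≡1+wl , wk≤wl , wq≤wi ←
           value-crossing w {λ x → ϱ α p <ₙ ϱ α x} (λ x → ϱ α p ℕ.<? ϱ α x)
             (toℕ (w ⟨$⟩ʳ i) ∸ toℕ (w ⟨$⟩ʳ k)) (ℕ.m∸n+n≡m (ℕ.<⇒≤ wk<wi)) ϱp<ϱk (ℕ.<-asym ϱi<ϱp)
    = q , ϱq≡ϱp , subst (toℕ (w ⟨$⟩ʳ k) <ₙ_) (sym wq≡1+wl) (s≤s wk≤wl) , wq<wp
    where
    wq<wp : (w ⟨$⟩ʳ q) < (w ⟨$⟩ʳ p)
    wq<wp = ℕ.≤-<-trans wq≤wi wi<wp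
    ϱq≡ϱp : ϱ α q ≡ ϱ α p
    ϱq≡ϱp with ℕ.m≤n⇒m<n∨m≡n (ℕ.≮⇒≥ ϱp≮ϱq)
    ... | inj₂ eq    = eq
    ... | inj₁ ϱq<ϱp = contradiction
      ( q , p , l , (ϱ<ϱ⇒< ϱq<ϱp , ϱ<ϱ⇒< ϱp<ϱl)
      , (ℕ.<⇒≢ ϱq<ϱp , ℕ.<⇒≢ ϱp<ϱl , ℕ.<⇒≢ (ℕ.<-trans ϱq<ϱp ϱp<ϱl)) , wq<wp , wq≡1+wl ) no231

  -- Inversions of a pattern-avoiding permutation as chains of runs

  module _ {w : Permutation′ n} (inSα : InSα α w) (no231 : ¬ Has231 α w) where

    private
      increasing : ∀ {i j} → i < j → ϱ α i ≡ ϱ α j → (w ⟨$⟩ʳ i) < (w ⟨$⟩ʳ j)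
      increasing = InSα⇒increasing {w} inSα

    inverted⇒ϱ<ϱ : ∀ {i j} → i < j → (w ⟨$⟩ʳ j) < (w ⟨$⟩ʳ i) → ϱ α i <ₙ ϱ α j
    inverted⇒ϱ<ϱ {i} {j} i<j wj<wi =
      ℕ.≤∧≢⇒< (ϱ-mono {i} {j} (ℕ.<⇒≤ i<j)) (Fin.<-asym wj<wi ∘ increasing i<j)

    -- The position `p` just after the run of `i` carries a value above `w i`. Pattern avoidance
    -- yields `q` in the region of `p` with value between `w k` and `w p`; as `w` increases there,
    -- `q` lies left of `p`, hence in the run.
    beyond-run : ∀ {i k} → ¬ pos k ≤ₙ runEnd w i → (w ⟨$⟩ʳ k) < (w ⟨$⟩ʳ i) →
                 ∃[ q ] Run (runEnd w) i q × q < k × (w ⟨$⟩ʳ k) < (w ⟨$⟩ʳ q)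
    beyond-run {i} {k} k≰e wk<wi =
      let p , pos-p = at-position {suc (runEnd w i)} (s≤s z≤n) (ℕ.≤-trans (ℕ.≰⇒> k≰e) (Fin.toℕ<n k))
      in from-stop p pos-p
      where
      from-stop : ∀ p → pos p ≡ suc (runEnd w i) →
                  ∃[ q ] Run (runEnd w) i q × q < k × (w ⟨$⟩ʳ k) < (w ⟨$⟩ʳ q)
      from-stop p pos-p =
        let q , ϱq≡ϱp , wk<wq , wq<wp = intermediate-in-region {w} no231 ϱi<ϱp ϱp<ϱk wk<wi wi<wp
            ϱi<ϱq = subst (ϱ α i <ₙ_) (sym ϱq≡ϱp) ϱi<ϱp
            ϱq<ϱk = subst (_<ₙ ϱ α k) (sym ϱq≡ϱp) ϱp<ϱk
        in q , (ϱ<ϱ⇒end<pos ϱi<ϱq , s≤s⁻¹ (subst (pos q <ₙ_) pos-p (s≤s (left-of-p ϱq≡ϱp wq<wp))))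
             , ϱ<ϱ⇒< ϱq<ϱk , wk<wq
        where
        spec = runEnd-spec w i

        ϱi<ϱp : ϱ α i <ₙ ϱ α p
        ϱi<ϱp = end<pos⇒ϱ<ϱ (subst (end i <ₙ_) (sym pos-p) (s≤s (end≤ spec)))

        wi<wp : (w ⟨$⟩ʳ i) < (w ⟨$⟩ʳ p)
        wi<wp = ℕ.≤∧≢⇒< (ℕ.≮⇒≥ (outside spec p pos-p))
          (Fin.<⇒≢ (ϱ<ϱ⇒< ϱi<ϱp) ∘ ⟨$⟩ʳ-injective w ∘ Fin.toℕ-injective)

        wk<wp : (w ⟨$⟩ʳ k) < (w ⟨$⟩ʳ p)
        wk<wp = Fin.<-trans wk<wi wi<wp

        p<k : p < k
        p<k = ℕ.≤∧≢⇒< (s≤s⁻¹ (subst (_≤ₙ pos k) (sym pos-p) (ℕ.≰⇒> k≰e)))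
          λ p≡k → Fin.<⇒≢ wk<wp (cong (w ⟨$⟩ʳ_) (sym (Fin.toℕ-injective p≡k)))

        ϱp<ϱk : ϱ α p <ₙ ϱ α k
        ϱp<ϱk = inverted⇒ϱ<ϱ p<k wk<wp

        left-of-p : ∀ {q} → ϱ α q ≡ ϱ α p → (w ⟨$⟩ʳ q) < (w ⟨$⟩ʳ p) → q < p
        left-of-p {q} ϱq≡ϱp wq<wp with Fin.<-cmp q p
        ... | tri< q<p _ _  = q<p
        ... | tri≈ _ q≡p _ = contradiction (cong (w ⟨$⟩ʳ_) q≡p) (Fin.<⇒≢ wq<wp)
        ... | tri> _ _ p<q  = contradiction wq<wp (Fin.<-asym (increasing p<q (sym ϱq≡ϱp)))

    -- Either `k` lies in the run of `i`, or one run leads to some `q` further right that is still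
    -- inverted with `k`; induction continues from `q`.
    inverted⇒Reach : ∀ {i k} → Inv w (i , k) → Reach (runEnd w) i k
    inverted⇒Reach = go (>-wellFounded _)
      where
      go : ∀ {i k} → Acc _>ᶠ_ i → Inv w (i , k) → Reach (runEnd w) i k
      go {i} {k} (acc rec) (i<k , wk<wi) with pos k ℕ.≤? runEnd w i
      ... | yes k≤e = [ ϱ<ϱ⇒end<pos (inverted⇒ϱ<ϱ i<k wk<wi) , k≤e ]
      ... | no  k≰e = let q , run , q<k , wk<wq = beyond-run k≰e wk<wi in
        run ∷ go (rec (end<pos⇒< (proj₁ run))) (q<k , wk<wq)

  -- Construction of a permutation with prescribed runs

  module _ {e : Fin n → ℕ} (adm : Admissible e) where
    open Admissible adm

    -- Only the first run of a chain depends on its source, and the run of `j` starts at the same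
    -- place as that of `i` and is at least as long.
    Reach-same-region : ∀ {i j k} → ϱ α i ≡ ϱ α j → i ≤ᶠ j → Reach e i k → Reach e j k
    Reach-same-region {i} {j} ϱ≡ i≤j = λ where
        [ run ]     → [ shift run ]
        (run ∷ q→k) → shift run ∷ q→k
      where
      shift : ∀ {k} → Run e i k → Run e j k
      shift {k} (end<k , k≤e) = subst (_<ₙ pos k) (cong s ϱ≡) end<k , ℕ.≤-trans k≤e (e-mono ϱ≡ i≤j)

    -- If `j` shares the region of `i`, it takes over the chain to `k`; if it lies in the run of
    -- `i`, that run reaches it. Otherwise the first run lands left of `j`, and induction applies to
    -- the rest of the chain.
    Reach-cotrans : ∀ {i j k} → i < j → j < k → Reach e i k → Reach e i j ⊎ Reach e j k
    Reach-cotrans {i} {j} i<j j<k i→k with ℕ.m≤n⇒m<n∨m≡n (ϱ-mono {i} {j} (ℕ.<⇒≤ i<j))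
    ... | inj₂ ϱi≡ϱj = inj₂ (Reach-same-region ϱi≡ϱj (ℕ.<⇒≤ i<j) i→k)
    ... | inj₁ ϱi<ϱj with pos j ℕ.≤? e i | i→k
    ...   | yes j≤e | _             = inj₁ [ ϱ<ϱ⇒end<pos ϱi<ϱj , j≤e ]
    ...   | no  j≰e | [ _ , k≤e ]   = contradiction (ℕ.≤-trans (s≤s (ℕ.<⇒≤ j<k)) k≤e) j≰e
    ...   | no  j≰e | run@(_ , q≤e) ∷ q→k
      with Reach-cotrans (s≤s⁻¹ (ℕ.≤-<-trans q≤e (ℕ.≰⇒> j≰e))) j<k q→k
    ...     | inj₁ q→j = inj₁ (run ∷ q→j)
    ...     | inj₂ j→k = inj₂ j→k

    -- A chain cannot leave the run of `i` exactly at its stop. An intermediate `q` lies in a region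
    -- before that of `k`, so `end q ≤ e i` and nesting gives `e q ≤ e i`; the next step therefore
    -- stays in the run of `i`.
    Reach-avoids-stop : ∀ {i k} → pos k ≡ suc (e i) → ¬ Reach e i k
    Reach-avoids-stop {i} {k} pos-k = λ where
        [ _ , k≤e ] → beyond k≤e
        (run ∷ q→k) → from-run run q→k
      where
      beyond : ¬ pos k ≤ₙ e i
      beyond k≤e = ℕ.1+n≰n (subst (_≤ₙ e i) pos-k k≤e)

      run-nested : ∀ {q} → Run e i q → Reach e q k → e q ≤ₙ e i
      run-nested {q} (end<q , _) q→k = nested (end<pos⇒ϱ<ϱ end<q)
        (s≤s⁻¹ (subst (end q <ₙ_) pos-k (ϱ<ϱ⇒end<pos (Reach⇒ϱ<ϱ q→k))))

      from-run : ∀ {q} → Run e i q → ¬ Reach e q k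
      from-run run q→k@([ _ , k≤e ]) = beyond (ℕ.≤-trans k≤e (run-nested run q→k))
      from-run run@(end<q , _) q→k@((end<q′ , q′≤e) ∷ q′→k) = from-run
        ( ϱ<ϱ⇒end<pos (ℕ.<-trans (end<pos⇒ϱ<ϱ end<q) (end<pos⇒ϱ<ϱ end<q′))
        , ℕ.≤-trans q′≤e (run-nested run q→k)) q′→k

    realize-runs : ∃[ w ] InSα α w × ¬ Has231 α w × (∀ i → IsRunEnd w i (e i))
    realize-runs = w , inSα , no231 , isRunEnd
      where
      realized = realize-inversions (Reach? e) (ϱ<ϱ⇒< ∘ Reach⇒ϱ<ϱ) _++_ Reach-cotrans

      w : Permutation′ n
      w = proj₁ realized

      inverted : ∀ {i j} → Reach e i j → (w ⟨$⟩ʳ j) < (w ⟨$⟩ʳ i)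
      inverted = proj₁ (proj₂ realized)

      ordered : ∀ {i j} → i < j → ¬ Reach e i j → (w ⟨$⟩ʳ i) < (w ⟨$⟩ʳ j)
      ordered = proj₂ (proj₂ realized)

      inSα : InSα α w
      inSα i j pos-j ϱ≡ = ordered (ℕ.≤-reflexive (sym (ℕ.suc-injective pos-j)))
        (λ i→j → ℕ.<⇒≢ (Reach⇒ϱ<ϱ i→j) ϱ≡)

      no231 : ¬ Has231 α w
      no231 (i , j , k , (i<j , j<k) , (ϱi≢ϱj , _ , _) , wi<wj , wi≡1+wk) with Reach? e i k
      ... | no ¬i→k = contradiction (ordered (Fin.<-trans i<j j<k) ¬i→k)
        (Fin.<-asym (ℕ.≤-reflexive (sym wi≡1+wk)))
      -- A single run from `i` to `k` also covers `j`, which forces `w j` below `w i`.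
      ... | yes [ _ , k≤e ] = contradiction wi<wj (Fin.<-asym (inverted
        [ ϱ<ϱ⇒end<pos (ℕ.≤∧≢⇒< (ϱ-mono {i} {j} (ℕ.<⇒≤ i<j)) ϱi≢ϱj)
        , ℕ.≤-trans (s≤s (ℕ.<⇒≤ j<k)) k≤e ]))
      -- The value at the intermediate point `q` would lie strictly between the consecutive values
      -- `w k` and `w i`.
      ... | yes (run ∷ q→k) = ℕ.<⇒≱ (inverted [ run ])
        (subst (_≤ₙ _) (sym wi≡1+wk) (inverted q→k))

      isRunEnd : ∀ i → IsRunEnd w i (e i)
      isRunEnd i = record
        { end≤    = end≤e i
        ; ≤n      = e≤n i
        ; inside  = λ k end<k k≤e → inverted [ end<k , k≤e ]
        ; outside = λ k pos-k wk<wi → Fin.<-asym wk<wi (ordered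
            (end<pos⇒< (subst (end i <ₙ_) (sym pos-k) (s≤s (end≤e i)))) (Reach-avoids-stop pos-k))
        }

theorem1p1 : (n : ℕ) → n > 0 → (α : Composition n) → Tamari α ≅ CPoset α
theorem1p1 n _ α = f , record
  { isOrderMonomorphism = record
    { isOrderHomomorphism = record
      { cong = λ {u} {v} → f-cong {u} {v}
      ; mono = λ {u} {v} → mono {u} {v}
      }
    ; injective = λ {u} {v} fu≈fv → T.antisym {u} {v}
        (cancel {u} {v} (CP.reflexive {f u} {f v} fu≈fv))
        (cancel {v} {u} (CP.reflexive {f v} {f u} (λ i → sym (fu≈fv i))))
    ; cancel = λ {u} {v} → cancel {u} {v}
    }
  ; surjective = surj
  }
  where
  module T = Poset (Tamari α)
  module CP = Poset (CPoset α)

  f : T.Carrier → CP.Carrier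
  f (w , inSα , _) = code α (runEnd α w) , code∈Cα α (runEnd-admissible α {w} inSα)

  mono : ∀ {u v} → u T.≤ v → f u CP.≤ f v
  mono {u , _} {v , _} u≤v i = +≤+ (ℕ.∸-monoˡ-≤ (end α i) (runEnd-monotone α {u} {v} u≤v i))

  f-cong : ∀ {u v} → u T.≈ v → f u CP.≈ f v
  f-cong {u} {v} u≈v = CP.antisym {f u} {f v}
    (mono {u} {v} (T.reflexive {u} {v} u≈v)) (mono {v} {u} (T.reflexive {v} {u} (T.Eq.sym {u} {v} u≈v)))

  cancel : ∀ {u v} → f u CP.≤ f v → u T.≤ v
  -- An inversion of `u` is a chain of runs of `u`; these are contained in the runs of `v`, whose
  -- chains are inversions of `v`.
  cancel {u , inSα , no231} {v , _} fu≤fv (i , k) inv@(i<k , _) =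
    i<k , Reach⇒inverted α (runEnd-spec α v) (Reach-monotone α runEnd≤ (inverted⇒Reach α {u} inSα no231 inv))
    where
    runEnd≤ : ∀ i → runEnd α u i ≤ₙ runEnd α v i
    runEnd≤ i = subst₂ _≤ₙ_
      (ℕ.m∸n+n≡m (IsRunEnd.end≤ (runEnd-spec α u i))) (ℕ.m∸n+n≡m (IsRunEnd.end≤ (runEnd-spec α v i)))
      (ℕ.+-monoˡ-≤ (end α i) (ℤ.drop‿+≤+ (fu≤fv i)))

  -- Run ends are unique, so the computed ones agree with those decoded from `c`.
  code-runEnd : ∀ {c w} → C1 α c → (∀ i → IsRunEnd α w i (decode α c i)) →
                ∀ i → code α (runEnd α w) i ≡ c i
  code-runEnd {c} {w} c1 runs i = trans
    (cong (λ e → + (e ∸ end α i)) (IsRunEnd-unique α (runEnd-spec α w i) (runs i)))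
    (trans (cong +_ (ℕ.m+n∸n≡m ∣ c i ∣ (end α i))) (ℤ.0≤i⇒+∣i∣≡i (proj₁ (c1 i))))

  surj : ∀ c → ∃[ u ] (∀ {v} → v T.≈ u → f v CP.≈ c)
  surj (c , c1 , c2 , c3) =
    let w , inSα , no231 , runs = realize-runs α (decode-admissible α {c} c1 c2 c3)
        u = w , inSα , no231
    in u , λ {v} v≈u → CP.Eq.trans {f v} {f u} {c , c1 , c2 , c3}
                         (f-cong {v} {u} v≈u) (code-runEnd c1 runs)
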